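{- For all integers $q\ge1$ and $n\ge1$, the number of nonattacking placements of $q$ unlabelled semibishops on the $n\times n$ square board is $$u_{\mathsf Q^{01}}(q;n)=(-1)^q\sum_{k=0}^q s(n+1,n+1-k)\,s(n,n-(q-k)),$$ which is a polynomial function of $n$ of degree $2q$.
   Context: The semibishop $\mathsf Q^{01}$ is the rider with the single basic move $(1,1)$: two pieces at positions $z,z'\in[n]^2=\{1,\dots,n\}^2$ attack each other if $z'-z$ is an integer multiple of $(1,1)$ (including $z=z'$). $u_{\mathsf Q^{01}}(q;n)$ counts the sets of $q$ positions in $[n]^2$ no two of which attack each other. $s(a,b)$ denotes the signed Stirling number of the first kind, taken to be $0$ if $b<0$ or $b>a$. -}

module Defs where

open import Data.Nat as ℕ using (ℕ; zero; suc)
open import Data.Integer as ℤ using (ℤ; +_; -[1+_]; 0ℤ; 1ℤ)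
import Data.Integer.Properties as ℤ
open import Data.Rational as ℚ using (ℚ; 0ℚ)
import Data.Rational.Properties as ℚ
open import Data.Fin using (Fin; toℕ; fromℕ; remQuot)
open import Data.Fin.Properties as Fin using (all?)
open import Data.Fin.Subset using (Subset; inside; outside; _∈_; ∣_∣)
open import Data.Fin.Subset.Properties using (_∈?_)
open import Data.List using (List; []; _∷_; _++_; map; filter; length)
open import Data.Vec using ([]; _∷_)
open import Data.Vec.Functional using (Vector)
open import Data.Product using (_×_; _,_; proj₁; proj₂; Σ-syntax; ∃-syntax)
open import Relation.Nullary using (¬_; Dec)
open import Relation.Nullary.Decidable using (map′; _→-dec_; _×-dec_; ¬?)
open import Relation.Unary using (Decidable)
open import Relation.Binary.PropositionalEquality using (_≡_; _≢_; sym; trans)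
open import Algebra.Bundles using (CommutativeMonoid)
open import Algebra.Properties.Monoid.Sum (CommutativeMonoid.monoid ℚ.+-0-commutativeMonoid) using (sum⁺-syntax)

-- The n² squares of the board are indexed by Fin (n * n), so that a set of
-- positions is a Subset (n * n); the coordinates lie in {1,…,n}.
position : ∀ {n} → Fin (n ℕ.* n) → ℤ × ℤ
position {n} i = + suc (toℕ (proj₁ (remQuot {n} n i))) , + suc (toℕ (proj₂ (remQuot {n} n i)))

Attacks : ℤ × ℤ → ℤ × ℤ → Set
Attacks (x , y) (x′ , y′) = ∃[ k ] (x′ ℤ.- x ≡ k ℤ.* 1ℤ × y′ ℤ.- y ≡ k ℤ.* 1ℤ)

attacks? : ∀ z z′ → Dec (Attacks z z′)
attacks? (x , y) (x′ , y′) = map′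
  (λ e → x′ ℤ.- x , sym (ℤ.*-identityʳ _) , trans (sym e) (sym (ℤ.*-identityʳ _)))
  (λ { (k , e , e′) → trans e (sym e′) })
  (x′ ℤ.- x ℤ.≟ y′ ℤ.- y)

Nonattacking : ∀ {n} → Subset (n ℕ.* n) → Set
Nonattacking {n} p =
  ∀ i j → i ∈ p → j ∈ p → i ≢ j → ¬ Attacks (position {n} i) (position {n} j)

nonattacking? : ∀ {n} → Decidable (Nonattacking {n})
nonattacking? {n} p = all? λ i → all? λ j →
  (i ∈? p) →-dec ((j ∈? p) →-dec
    (¬? (i Fin.≟ j) →-dec ¬? (attacks? (position {n} i) (position {n} j))))

-- Every subset of Fin m, listed exactly once.
subsets : ∀ m → List (Subset m)
subsets zero    = [] ∷ []
subsets (suc m) = map (outside ∷_) (subsets m) ++ map (inside ∷_) (subsets m)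

Placement : ∀ q n → Subset (n ℕ.* n) → Set
Placement q n p = ∣ p ∣ ≡ q × Nonattacking {n} p

placement? : ∀ q n → Decidable (Placement q n)
placement? q n p = (∣ p ∣ ℕ.≟ q) ×-dec nonattacking? {n} p

u : ℕ → ℕ → ℕ
u q n = length (filter (placement? q n) (subsets (n ℕ.* n)))

-- stirling₁ a b is the coefficient of xᵇ in x (x - 1) ⋯ (x - (a - 1)).
stirling₁ : ℕ → ℕ → ℤ
stirling₁ zero    zero    = 1ℤ
stirling₁ zero    (suc b) = 0ℤ
stirling₁ (suc a) zero    = ℤ.- (+ a ℤ.* stirling₁ a zero)
stirling₁ (suc a) (suc b) = stirling₁ a b ℤ.- + a ℤ.* stirling₁ a (suc b)

-- Extension by 0 to negative lower index; stirling₁ a b is already 0 for b > a.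
s : ℕ → ℤ → ℤ
s a (+ b)    = stirling₁ a b
s a -[1+ b ] = 0ℤ

-- On the positive integers, f agrees with a rational polynomial of degree
-- exactly d; c i is the coefficient of nⁱ.
IsPolynomialOfDegree : ℕ → (ℕ → ℕ) → Set
IsPolynomialOfDegree d f =
  Σ[ c ∈ Vector ℚ (suc d) ]
    (c (fromℕ d) ≢ 0ℚ ×
     (∀ n → 1 ℕ.≤ n → (+ f n) ℚ./ 1 ≡ ∑[ i ≤ d ] (c i ℚ.* ((+ (n ℕ.^ toℕ i)) ℚ./ 1))))

{-# OPTIONS --safe #-}
module Submission where

open import Defs
open import Data.Nat using (ℕ; suc; _≤_)
import Data.Nat as ℕ
open import Data.Integer using (+_; -1ℤ; _-_; _*_; _^_)
open import Data.Integer.Properties using (+-0-monoid)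
open import Data.Fin using (toℕ)
open import Data.Product using (_×_)
open import Relation.Binary.PropositionalEquality using (_≡_)
open import Algebra.Properties.Monoid.Sum +-0-monoid using (sum⁺-syntax)

open import Data.Nat using (zero; _<_; s≤s; _∸_)
import Data.Nat.Properties as ℕ
open import Data.Nat.Tactic.RingSolver using (solve-∀)
open import Data.Integer using (ℤ; -[1+_]; 0ℤ; 1ℤ; _+_; _⊖_)
import Data.Integer as ℤ
import Data.Integer.Properties as ℤ
import Data.Integer.Tactic.RingSolver as ℤ-Solver
open import Data.Rational as ℚ using (ℚ; 0ℚ; 1ℚ)
import Data.Rational.Properties as ℚ
open import Data.Rational.Solver using (module +-*-Solver)
import Data.Rational.Unnormalised as ℚᵘ
import Data.Rational.Unnormalised.Properties as ℚᵘ
open import Data.Bool using (true; false; if_then_else_)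
open import Data.Fin using (Fin; zero; suc; fromℕ; remQuot; _↑ˡ_; _↑ʳ_)
import Data.Fin.Properties as Fin
open import Data.Fin.Subset using (Subset; inside; outside; ∣_∣)
import Data.Fin.Subset as Subset
import Data.Fin.Subset.Properties as Subset
open import Data.Vec using ([]; _∷_; here; there)
open import Data.Vec.Functional using (Vector; tail)
open import Data.List using (List; []; _∷_; _++_; map; filter; length; applyUpTo; applyDownFrom)
import Data.List.Properties as List
open import Data.List.Membership.Propositional using (_∈_; _∉_)
open import Data.List.Membership.Propositional.Properties using (∈-++⁺ˡ; ∈-++⁺ʳ; ∈-applyUpTo⁺; ∈-applyUpTo⁻)
import Data.List.Membership.DecPropositional as DecMembership
open import Data.List.Relation.Unary.Any using (here; there)
import Data.List.Relation.Unary.All as All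
open import Data.List.Relation.Unary.AllPairs using (_∷_)
open import Data.List.Relation.Unary.Unique.Propositional using (Unique)
import Data.List.Relation.Unary.Unique.Propositional.Properties as Unique
open import Data.Product using (_,_; proj₁; proj₂; Σ-syntax)
open import Data.Sum using (inj₁; inj₂)
open import Function using (_∘_; case_of_)
open import Level using (0ℓ)
open import Relation.Nullary using (¬_; yes; no; does)
open import Relation.Nullary.Decidable using (_→-dec_; _×-dec_; ¬?; dec-true; dec-false)
open import Relation.Unary using (Pred; Decidable; _≐_)
open import Relation.Binary.Definitions using (DecidableEquality)
open import Relation.Binary.PropositionalEquality
open import Algebra.Properties.Semiring.Sum ℕ.+-*-semiring
  using (sum; sum-syntax; sum-cong-≗; sum-replicate-zero; ∑-distrib-+)
import Algebra.Properties.Semiring.Sum ℤ.+-*-semiring as ℤ-Sum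
import Algebra.Properties.Monoid.Sum ℚ.+-0-monoid as ℚ-Sum
open +-*-Solver using (solve; _:=_; _:+_; _:-_; _:*_; :-_; con)

-- Two squares attack each other iff they lie on the same diagonal y − x = d, so
-- a nonattacking placement chooses q diagonals and one square on each: the
-- count is the elementary symmetric polynomial e_q of the diagonal lengths
-- n, …, 1, n − 1, …, 1. Since s(n+1, n+1−k) = (−1)ᵏ e_k(1, …, n), splitting e_q
-- over the two halves gives the Stirling formula. Passing from n to n + 1
-- adjoins the lengths n + 1 and n, so that
-- Δ e_{q+1} = (2n + 1) e_q + n (n + 1) e_{q−1}; summing this raises the degree
-- by two at each step, and keeps the leading coefficient positive.

-- Elementary symmetric polynomials and rainbow subsets

esym : ℕ → List ℕ → ℕ
esym zero    _        = 1
esym (suc q) []       = 0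
esym (suc q) (a ∷ as) = esym (suc q) as ℕ.+ a ℕ.* esym q as

esym-0∷ : ∀ q as → esym q (0 ∷ as) ≡ esym q as
esym-0∷ zero    as = refl
esym-0∷ (suc q) as = ℕ.+-identityʳ _

esym-zeros : ∀ {A : Set} {f : A → ℕ} → (∀ x → f x ≡ 0) → ∀ q xs → esym (suc q) (map f xs) ≡ 0
esym-zeros f≡0 q []       = refl
esym-zeros f≡0 q (x ∷ xs) rewrite f≡0 x | esym-zeros f≡0 q xs = refl

map-cong-∈ : ∀ {A B : Set} {f g : A → B} {xs} → (∀ {x} → x ∈ xs → f x ≡ g x) → map f xs ≡ map g xs
map-cong-∈ f≡g = List.map-cong-local (All.tabulate f≡g)

-- w exceeds w⁻ by one unit at c; the new terms are those that use this unit,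
-- and they use nothing else at c.
esym-raise : ∀ {C : Set} {w w⁻ w⁰ : C → ℕ} {c cs} → Unique cs → c ∈ cs →
  w c ≡ suc (w⁻ c) → w⁰ c ≡ 0 →
  (∀ {d} → c ≢ d → w d ≡ w⁻ d) → (∀ {d} → c ≢ d → w⁰ d ≡ w⁻ d) →
  ∀ q → esym (suc q) (map w cs) ≡ esym (suc q) (map w⁻ cs) ℕ.+ esym q (map w⁰ cs)
esym-raise {w = w} {w⁻} {w⁰} {c} {_ ∷ cs} (c∉ ∷ _) (here refl) wc w⁰c w≗ w⁰≗ q
  rewrite map-cong-∈ {f = w} {w⁻} {cs} (w≗ ∘ All.lookup c∉)
        | map-cong-∈ {f = w⁰} {w⁻} {cs} (w⁰≗ ∘ All.lookup c∉)
        | wc | w⁰c | esym-0∷ q (map w⁻ cs) =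
  lemma (esym (suc q) (map w⁻ cs)) (esym q (map w⁻ cs)) (w⁻ c)
  where
  lemma : ∀ x y a → x ℕ.+ suc a ℕ.* y ≡ x ℕ.+ a ℕ.* y ℕ.+ y
  lemma = solve-∀
esym-raise {w = w} {w⁻} {w⁰} {cs = d ∷ cs} (d∉ ∷ u) (there c∈) wc w⁰c w≗ w⁰≗ zero
  rewrite w≗ (≢-sym (All.lookup d∉ c∈)) | esym-raise u c∈ wc w⁰c w≗ w⁰≗ 0 =
  lemma (esym 1 (map w⁻ cs)) (w⁻ d)
  where
  lemma : ∀ x a → x ℕ.+ 1 ℕ.+ a ℕ.* 1 ≡ x ℕ.+ a ℕ.* 1 ℕ.+ 1
  lemma = solve-∀
esym-raise {w = w} {w⁻} {w⁰} {cs = d ∷ cs} (d∉ ∷ u) (there c∈) wc w⁰c w≗ w⁰≗ (suc q)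
  rewrite w≗ (≢-sym (All.lookup d∉ c∈)) | w⁰≗ (≢-sym (All.lookup d∉ c∈))
        | esym-raise u c∈ wc w⁰c w≗ w⁰≗ (suc q)
        | esym-raise u c∈ wc w⁰c w≗ w⁰≗ q = lemma (esym (suc (suc q)) (map w⁻ cs)) (esym (suc q) (map w⁻ cs))
            (esym (suc q) (map w⁰ cs)) (esym q (map w⁰ cs)) (w⁻ d)
  where
  lemma : ∀ x x′ y y′ a → x ℕ.+ y ℕ.+ a ℕ.* (x′ ℕ.+ y′) ≡ x ℕ.+ a ℕ.* x′ ℕ.+ (y ℕ.+ a ℕ.* y′)
  lemma = solve-∀

length-filter-map : ∀ {A B : Set} {P : Pred B 0ℓ} (P? : Decidable P) (f : A → B) xs →
  length (filter P? (map f xs)) ≡ length (filter (P? ∘ f) xs)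
length-filter-map P? f []       = refl
length-filter-map P? f (x ∷ xs) with does (P? (f x))
... | true  = cong suc (length-filter-map P? f xs)
... | false = length-filter-map P? f xs

length-filter-none : ∀ {A : Set} {P : Pred A 0ℓ} (P? : Decidable P) → (∀ x → ¬ P x) → ∀ xs →
  length (filter P? xs) ≡ 0
length-filter-none P? ¬P xs = cong length (List.filter-none P? {xs} (All.tabulate λ {x} _ → ¬P x))

module Rainbow {C : Set} (_≟_ : DecidableEquality C) where
  open DecMembership _≟_ using (_∈?_)

  -- F holds the colours used up by the elements already chosen in the recursion
  -- on subsets.
  Rainbow : ∀ {m} → (Fin m → C) → List C → ℕ → Subset m → Set
  Rainbow col F q p = ∣ p ∣ ≡ q
    × (∀ i j → i Subset.∈ p → j Subset.∈ p → i ≢ j → col i ≢ col j)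
    × (∀ i → i Subset.∈ p → col i ∉ F)

  rainbow? : ∀ {m} (col : Fin m → C) F q → Decidable (Rainbow col F q)
  rainbow? col F q p = (∣ p ∣ ℕ.≟ q)
    ×-dec Fin.all? (λ i → Fin.all? λ j → (i Subset.∈? p) →-dec ((j Subset.∈? p) →-dec
            (¬? (i Fin.≟ j) →-dec ¬? (col i ≟ col j))))
    ×-dec Fin.all? (λ i → (i Subset.∈? p) →-dec ¬? (col i ∈? F))

  #rainbow : ∀ {m} → (Fin m → C) → List C → ℕ → ℕ
  #rainbow {m} col F q = length (filter (rainbow? col F q) (subsets m))

  ⟦_≟_⟧ : C → C → ℕ
  ⟦ c ≟ d ⟧ = if does (c ≟ d) then 1 else 0

  ⟦≟⟧-yes : ∀ c → ⟦ c ≟ c ⟧ ≡ 1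
  ⟦≟⟧-yes c rewrite dec-true (c ≟ c) refl = refl

  ⟦≟⟧-no : ∀ {c d} → c ≢ d → ⟦ c ≟ d ⟧ ≡ 0
  ⟦≟⟧-no {c} {d} c≢d rewrite dec-false (c ≟ d) c≢d = refl

  classSize : ∀ {m} → (Fin m → C) → C → ℕ
  classSize {m} col d = ∑[ i < m ] ⟦ col i ≟ d ⟧

  -- A used-up colour gets weight 0 instead of being deleted from the list of colours, so one list
  -- `cs` serves the whole recursion on `m`.
  weight : ∀ {m} → (Fin m → C) → List C → C → ℕ
  weight col F d = if does (d ∈? F) then 0 else classSize col d

  weight-∈ : ∀ {m} (col : Fin m → C) {F d} → d ∈ F → weight col F d ≡ 0
  weight-∈ col {F} {d} d∈F rewrite dec-true (d ∈? F) d∈F = refl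

  weight-∉ : ∀ {m} (col : Fin m → C) {F d} → d ∉ F → weight col F d ≡ classSize col d
  weight-∉ col {F} {d} d∉F rewrite dec-false (d ∈? F) d∉F = refl

  weight-≢ : ∀ {m} (col : Fin (suc m) → C) F {d} → col zero ≢ d → weight col F d ≡ weight (col ∘ suc) F d
  weight-≢ col F {d} c≢d rewrite ⟦≟⟧-no c≢d = refl

  weight-∷ : ∀ {m} (col : Fin m → C) F {c d} → c ≢ d → weight col (c ∷ F) d ≡ weight col F d
  weight-∷ col F {c} {d} c≢d = case d ∈? F of λ where
    (yes d∈F) → trans (weight-∈ col {c ∷ F} (there d∈F)) (sym (weight-∈ col d∈F))
    (no  d∉F) → trans
      (weight-∉ col {c ∷ F} λ { (here d≡c) → c≢d (sym d≡c) ; (there d∈F) → d∉F d∈F })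
      (sym (weight-∉ col d∉F))

  rainbow-outside : ∀ {m} (col : Fin (suc m) → C) F q →
    (Rainbow col F q ∘ (outside ∷_)) ≐ Rainbow (col ∘ suc) F q
  rainbow-outside col F q =
    (λ { (s , r , f) → s , (λ i j i∈ j∈ i≢j → r (suc i) (suc j) (there i∈) (there j∈) (i≢j ∘ Fin.suc-injective))
                         , (λ i i∈ → f (suc i) (there i∈)) })
    , λ { (s , r , f) → s , (λ { (suc i) (suc j) (there i∈) (there j∈) i≢j → r i j i∈ j∈ (i≢j ∘ cong suc) })
                          , λ { (suc i) (there i∈) → f i i∈ } }

  -- Choosing element zero uses up its colour: the condition that the later elements differ from it
  -- in colour becomes the condition that they avoid the enlarged list `col zero ∷ F`.
  rainbow-inside : ∀ {m} (col : Fin (suc m) → C) F q → col zero ∉ F →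
    (Rainbow col F (suc q) ∘ (inside ∷_)) ≐ Rainbow (col ∘ suc) (col zero ∷ F) q
  rainbow-inside col F q c∉F =
    (λ { (s , r , f) → ℕ.suc-injective s
                     , (λ i j i∈ j∈ i≢j → r (suc i) (suc j) (there i∈) (there j∈) (i≢j ∘ Fin.suc-injective))
                     , λ { i i∈ (here e) → r (suc i) zero (there i∈) here (λ ()) e
                         ; i i∈ (there k) → f (suc i) (there i∈) k } })
    , λ { (s , r , f) → cong suc s
                      , (λ { zero zero _ _ i≢j _ → i≢j refl
                           ; zero (suc j) _ (there j∈) _ e → f j j∈ (here (sym e))
                           ; (suc i) zero (there i∈) _ _ e → f i i∈ (here e)
                           ; (suc i) (suc j) (there i∈) (there j∈) i≢j → r i j i∈ j∈ (i≢j ∘ cong suc) })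
                      , λ { zero _ → c∉F
                          ; (suc i) (there i∈) → f i i∈ ∘ there } }

  #rainbow-split : ∀ {m} (col : Fin (suc m) → C) F q → #rainbow col F q ≡
    #rainbow (col ∘ suc) F q ℕ.+ length (filter (rainbow? col F q ∘ (inside ∷_)) (subsets m))
  #rainbow-split {m} col F q = begin
    length (filter R? (map (outside ∷_) (subsets m) ++ map (inside ∷_) (subsets m)))
      ≡⟨ cong length (List.filter-++ R? (map (outside ∷_) (subsets m)) _) ⟩
    length (filter R? (map (outside ∷_) (subsets m)) ++ filter R? (map (inside ∷_) (subsets m)))
      ≡⟨ List.length-++ (filter R? (map (outside ∷_) (subsets m))) ⟩
    length (filter R? (map (outside ∷_) (subsets m))) ℕ.+ length (filter R? (map (inside ∷_) (subsets m)))
      ≡⟨ cong₂ ℕ._+_ (length-filter-map R? (outside ∷_) (subsets m)) (length-filter-map R? (inside ∷_) (subsets m)) ⟩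
    length (filter (R? ∘ (outside ∷_)) (subsets m)) ℕ.+ length (filter (R? ∘ (inside ∷_)) (subsets m))
      ≡⟨ cong (λ xs → length xs ℕ.+ length (filter (R? ∘ (inside ∷_)) (subsets m)))
           (List.filter-≐ (R? ∘ (outside ∷_)) (rainbow? (col ∘ suc) F q) (rainbow-outside col F q) (subsets m)) ⟩
    #rainbow (col ∘ suc) F q ℕ.+ length (filter (R? ∘ (inside ∷_)) (subsets m)) ∎
    where
    open ≡-Reasoning
    R? = rainbow? col F q

  #rainbow-∈ : ∀ {m} (col : Fin (suc m) → C) {F} q → col zero ∈ F →
    #rainbow col F q ≡ #rainbow (col ∘ suc) F q
  #rainbow-∈ {m} col {F} q c∈F = trans (#rainbow-split col F q) (trans
    (cong (#rainbow (col ∘ suc) F q ℕ.+_)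
      (length-filter-none (rainbow? col F q ∘ (inside ∷_)) (λ { p (_ , _ , f) → f zero here c∈F }) (subsets m)))
    (ℕ.+-identityʳ _))

  #rainbow-∉ : ∀ {m} (col : Fin (suc m) → C) {F} q → col zero ∉ F →
    #rainbow col F (suc q) ≡ #rainbow (col ∘ suc) F (suc q) ℕ.+ #rainbow (col ∘ suc) (col zero ∷ F) q
  #rainbow-∉ {m} col {F} q c∉F = trans (#rainbow-split col F (suc q))
    (cong (λ xs → #rainbow (col ∘ suc) F (suc q) ℕ.+ length xs)
      (List.filter-≐ (rainbow? col F (suc q) ∘ (inside ∷_)) (rainbow? (col ∘ suc) (col zero ∷ F) q)
        (rainbow-inside col F q c∉F) (subsets m)))

  -- Dropping element zero can only change the size of its own class, and the weight of that class
  -- is 0 on both sides because its colour lies in `F`.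
  esym-weight-∈ : ∀ {m} (col : Fin (suc m) → C) {F} cs q → col zero ∈ F →
    esym q (map (weight col F) cs) ≡ esym q (map (weight (col ∘ suc) F) cs)
  esym-weight-∈ col {F} cs q c∈F = cong (esym q) (List.map-cong same cs)
    where
    same : ∀ d → weight col F d ≡ weight (col ∘ suc) F d
    same d = case col zero ≟ d of λ where
      (yes refl) → trans (weight-∈ col c∈F) (sym (weight-∈ (col ∘ suc) c∈F))
      (no  c≢d)  → weight-≢ col F c≢d

  -- Dropping element zero takes one unit off the weight of its colour and leaves the other weights
  -- alone. This is the situation of `esym-raise`, whose third weight function comes from adding
  -- that colour to `F`.
  esym-weight-∉ : ∀ {m} (col : Fin (suc m) → C) {F cs} q → Unique cs → col zero ∈ cs → col zero ∉ F →
    esym (suc q) (map (weight col F) cs) ≡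
    esym (suc q) (map (weight (col ∘ suc) F) cs) ℕ.+ esym q (map (weight (col ∘ suc) (col zero ∷ F)) cs)
  esym-weight-∉ col {F} q u c∈cs c∉F = esym-raise u c∈cs
    (trans (weight-∉ col c∉F) (trans
      (cong (ℕ._+ classSize (col ∘ suc) (col zero)) (⟦≟⟧-yes (col zero)))
      (cong suc (sym (weight-∉ (col ∘ suc) c∉F)))))
    (weight-∈ (col ∘ suc) {col zero ∷ F} (here refl)) (weight-≢ col F) (weight-∷ (col ∘ suc) F) q

  -- A rainbow subset selects `q` colours outside `F` and one element of each, which is what the
  -- terms of the elementary symmetric polynomial count. By induction on `m`, both sides obey the
  -- same recursion on element zero; `F` is arbitrary because the inside case enlarges it. The
  -- hypotheses on `cs` ensure that the colour of element zero occurs there exactly once.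
  #rainbow≡esym : ∀ {m} (col : Fin m → C) {cs} → Unique cs → (∀ i → col i ∈ cs) → ∀ F q →
    #rainbow col F q ≡ esym q (map (weight col F) cs)
  #rainbow≡esym {zero} col u col∈ F zero =
    cong length (List.filter-accept (rainbow? col F 0) {[]} {[]} (refl , (λ ()) , λ ()))
  #rainbow≡esym {zero} col {cs} u col∈ F (suc q) = trans
    (cong length (List.filter-reject (rainbow? col F (suc q)) {[]} {[]} λ { (() , _) }))
    (sym (esym-zeros weight≡0 q cs))
    where
    weight≡0 : ∀ d → weight col F d ≡ 0
    weight≡0 d with d ∈? F
    ... | yes _ = refl
    ... | no  _ = refl
  #rainbow≡esym {suc m} col u col∈ F zero = trans (#rainbow-split col F 0) (cong₂ ℕ._+_
    (#rainbow≡esym (col ∘ suc) u (col∈ ∘ suc) F 0)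
    (length-filter-none (rainbow? col F 0 ∘ (inside ∷_)) (λ { p (() , _) }) (subsets m)))
  #rainbow≡esym {suc m} col {cs} u col∈ F (suc q) = case col zero ∈? F of λ where
    (yes c∈F) → trans (#rainbow-∈ col (suc q) c∈F) (trans
      (#rainbow≡esym (col ∘ suc) u (col∈ ∘ suc) F (suc q))
      (sym (esym-weight-∈ col cs (suc q) c∈F)))
    (no c∉F) → trans (#rainbow-∉ col q c∉F) (trans
      (cong₂ ℕ._+_ (#rainbow≡esym (col ∘ suc) u (col∈ ∘ suc) F (suc q))
                   (#rainbow≡esym (col ∘ suc) u (col∈ ∘ suc) (col zero ∷ F) q))
      (sym (esym-weight-∉ col q u (col∈ zero) c∉F)))

-- Diagonals of the board and their lengths

open Rainbow ℤ._≟_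

sum-splitAt : ∀ a b (f : Fin (a ℕ.+ b) → ℕ) → sum f ≡ ∑[ i < a ] f (i ↑ˡ b) ℕ.+ ∑[ j < b ] f (a ↑ʳ j)
sum-splitAt zero    b f = refl
sum-splitAt (suc a) b f = trans (cong (f zero ℕ.+_) (sum-splitAt a b (f ∘ suc))) (sym (ℕ.+-assoc (f zero) _ _))

sum-remQuot : ∀ a b (f : Fin a × Fin b → ℕ) →
  ∑[ i < a ℕ.* b ] f (remQuot {a} b i) ≡ ∑[ x < a ] ∑[ y < b ] f (x , y)
sum-remQuot zero    b f = refl
sum-remQuot (suc a) b f = trans (sum-splitAt b (a ℕ.* b) (f ∘ remQuot {suc a} b)) (cong₂ ℕ._+_
  (sum-cong-≗ λ j → cong f (first j))
  (trans (sum-cong-≗ λ j → cong f (rest j)) (sum-remQuot a b (λ (x , y) → f (suc x , y)))))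
  where
  first : ∀ j → remQuot {suc a} b (j ↑ˡ (a ℕ.* b)) ≡ (zero , j)
  first j rewrite Fin.splitAt-↑ˡ b j (a ℕ.* b) = refl
  rest : ∀ j → remQuot {suc a} b (b ↑ʳ j) ≡ (suc (proj₁ (remQuot {a} b j)) , proj₂ (remQuot {a} b j))
  rest j rewrite Fin.splitAt-↑ʳ b (a ℕ.* b) j = refl

diagonal : ∀ {n} → Fin n × Fin n → ℤ
diagonal (x , y) = toℕ y ⊖ toℕ x

diagonalSize : ℕ → ℤ → ℕ
diagonalSize n d = ∑[ x < n ] ∑[ y < n ] ⟦ diagonal (x , y) ≟ d ⟧

-- The row `x = 0` meets each of the diagonals `0, …, n` once, and the rest of the column `y = 0`
-- meets each of `−1, …, −n` once. Removing both leaves a board of side `n` on which `y − x` takes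
-- the same values after the shift.
diagonalSize-suc : ∀ n d → diagonalSize (suc n) d ≡
  ∑[ y < suc n ] ⟦ + toℕ y ≟ d ⟧ ℕ.+ (∑[ x < n ] ⟦ -[1+ toℕ x ] ≟ d ⟧ ℕ.+ diagonalSize n d)
diagonalSize-suc n d = cong (∑[ y < suc n ] ⟦ + toℕ y ≟ d ⟧ ℕ.+_) (trans
  (∑-distrib-+ {n} (λ x → ⟦ -[1+ toℕ x ] ≟ d ⟧) (λ x → ∑[ y < n ] ⟦ suc (toℕ y) ⊖ suc (toℕ x) ≟ d ⟧))
  (cong (∑[ x < n ] ⟦ -[1+ toℕ x ] ≟ d ⟧ ℕ.+_) (sum-cong-≗ {n} λ x → sum-cong-≗ {n} λ y →
    cong ⟦_≟ d ⟧ (ℤ.[1+m]⊖[1+n]≡m⊖n (toℕ y) (toℕ x)))))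

sum-none : ∀ n (f : ℕ → ℤ) {d} → (∀ i → f i ≢ d) → ∑[ i < n ] ⟦ f (toℕ i) ≟ d ⟧ ≡ 0
sum-none n f f≢d = trans (sum-cong-≗ {n} λ i → ⟦≟⟧-no (f≢d (toℕ i))) (sum-replicate-zero n)

-- Both sides are 1 if t < n, and 0 otherwise.
sum-one : ∀ n (f : ℕ → ℤ) → (∀ {i j} → f i ≡ f j → i ≡ j) → ∀ t →
  ∑[ i < n ] ⟦ f (toℕ i) ≟ f t ⟧ ≡ n ∸ t ∸ (n ∸ suc t)
sum-one zero    f f-inj t = sym (cong (_∸ (0 ∸ suc t)) (ℕ.0∸n≡0 t))
sum-one (suc n) f f-inj zero
  rewrite ⟦≟⟧-yes (f 0) | sum-none n (f ∘ suc) {f 0} (λ i e → case f-inj e of λ ()) = sym (ℕ.m+n∸n≡m 1 n)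
sum-one (suc n) f f-inj (suc t)
  rewrite ⟦≟⟧-no {f 0} {f (suc t)} (λ e → case f-inj e of λ ()) =
  sum-one n (f ∘ suc) (λ e → ℕ.suc-injective (f-inj e)) t

diagonalSize-pos : ∀ n t → diagonalSize n (+ t) ≡ n ∸ t
diagonalSize-pos zero    t = sym (ℕ.0∸n≡0 t)
diagonalSize-pos (suc n) t
  rewrite diagonalSize-suc n (+ t) | sum-none n -[1+_] {+ t} (λ _ ())
        | sum-one (suc n) +_ ℤ.+-injective t | diagonalSize-pos n t =
  -- `sum-one` gives the increment as `suc n ∸ t ∸ (n ∸ t)`, so it telescopes with the induction
  -- hypothesis without a case distinction on `t` and `n`.
  ℕ.m∸n+n≡m (ℕ.∸-monoˡ-≤ t (ℕ.n≤1+n n))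

diagonalSize-neg : ∀ n t → diagonalSize n -[1+ t ] ≡ n ∸ suc t
diagonalSize-neg zero    t = refl
diagonalSize-neg (suc n) t
  rewrite diagonalSize-suc n -[1+ t ] | sum-none (suc n) +_ { -[1+ t ]} (λ _ ())
        | sum-one n -[1+_] ℤ.-[1+-injective t | diagonalSize-neg n t =
  ℕ.m∸n+n≡m (ℕ.∸-monoʳ-≤ n (ℕ.n≤1+n t))

-- In this order the lengths are `n, …, 1` followed by `n − 1, …, 1`, the two lists that correspond
-- to the two Stirling factors.
diagonals : ℕ → List ℤ
diagonals n = applyUpTo +_ n ++ applyUpTo -[1+_] (n ∸ 1)

diagonals-unique : ∀ n → Unique (diagonals n)
diagonals-unique n = Unique.++⁺
  (Unique.applyUpTo⁺₁ +_ n λ i<j _ → ℕ.<⇒≢ i<j ∘ ℤ.+-injective)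
  (Unique.applyUpTo⁺₁ -[1+_] (n ∸ 1) λ i<j _ → ℕ.<⇒≢ i<j ∘ ℤ.-[1+-injective)
  λ { (d∈ , d∈′) → case ∈-applyUpTo⁻ +_ d∈ , ∈-applyUpTo⁻ -[1+_] d∈′ of λ { ((_ , _ , refl) , (_ , _ , ())) } }

m⊖[1+m+n] : ∀ m n → m ⊖ suc (m ℕ.+ n) ≡ -[1+ n ]
m⊖[1+m+n] m n = trans (cong₂ _⊖_ (sym (ℕ.+-identityʳ m)) (sym (ℕ.+-suc m n))) (ℤ.+-cancelˡ-⊖ m 0 (suc n))

∈-diagonals : ∀ n a b → a < n → b < n → b ⊖ a ∈ diagonals n
∈-diagonals n a b a<n b<n with ℕ.<-≤-connex b a
... | inj₂ a≤b rewrite ℤ.≤-⊖ a≤b = ∈-++⁺ˡ (∈-applyUpTo⁺ +_ (ℕ.≤-<-trans (ℕ.m∸n≤m b a) b<n))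
-- Here `a` is `suc (b ℕ.+ k)`, so the diagonal is `-[1+ k ]`, and `k < a ≤ n ∸ 1` puts it in the
-- second half.
... | inj₁ b<a with k , refl ← ℕ.m≤n⇒∃[o]m+o≡n b<a rewrite m⊖[1+m+n] b k =
  ∈-++⁺ʳ (applyUpTo +_ n) (∈-applyUpTo⁺ -[1+_] (ℕ.<-≤-trans (s≤s (ℕ.m≤n+m k b)) (ℕ.<⇒≤pred a<n)))

applyUpTo-∸ : ∀ n → applyUpTo (n ∸_) n ≡ applyDownFrom suc n
applyUpTo-∸ zero    = refl
applyUpTo-∸ (suc n) = cong (suc n ∷_) (applyUpTo-∸ n)

-- Nonattacking placements as rainbow subsets

attacks⇒y-x : ∀ z z′ → Attacks z z′ → proj₂ z - proj₁ z ≡ proj₂ z′ - proj₁ z′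
attacks⇒y-x (x , y) (x′ , y′) (k , e , e′) = begin
  y - x                          ≡⟨ swap x y x′ y′ ⟩
  y′ - x′ - (y′ - y - (x′ - x))  ≡⟨ cong₂ (λ a b → y′ - x′ - (a - b)) e′ e ⟩
  y′ - x′ - (k * 1ℤ - k * 1ℤ)    ≡⟨ cancel (y′ - x′) k ⟩
  y′ - x′                        ∎
  where
  open ≡-Reasoning
  swap : ∀ x y x′ y′ → y - x ≡ y′ - x′ - (y′ - y - (x′ - x))
  swap = ℤ-Solver.solve-∀
  cancel : ∀ a k → a - (k * 1ℤ - k * 1ℤ) ≡ a
  cancel = ℤ-Solver.solve-∀

y-x⇒attacks : ∀ z z′ → proj₂ z - proj₁ z ≡ proj₂ z′ - proj₁ z′ → Attacks z z′
y-x⇒attacks (x , y) (x′ , y′) e = x′ - x , sym (ℤ.*-identityʳ _) , (begin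
  y′ - y                         ≡⟨ swap x y x′ y′ ⟩
  (y′ - x′ - (y - x) + (x′ - x)) * 1ℤ ≡⟨ cong (λ a → (y′ - x′ - a + (x′ - x)) * 1ℤ) e ⟩
  (y′ - x′ - (y′ - x′) + (x′ - x)) * 1ℤ ≡⟨ cong (λ a → (a + (x′ - x)) * 1ℤ) (ℤ.+-inverseʳ (y′ - x′)) ⟩
  (0ℤ + (x′ - x)) * 1ℤ ≡⟨ cong (_* 1ℤ) (ℤ.+-identityˡ (x′ - x)) ⟩
  (x′ - x) * 1ℤ ∎)
  where
  open ≡-Reasoning
  swap : ∀ x y x′ y′ → y′ - y ≡ (y′ - x′ - (y - x) + (x′ - x)) * 1ℤ
  swap = ℤ-Solver.solve-∀

module _ (n : ℕ) where
  colour : Fin (n ℕ.* n) → ℤ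
  colour i = diagonal (remQuot {n} n i)

  diagonal-sizes : map (classSize colour) (diagonals n) ≡ applyDownFrom suc n ++ applyDownFrom suc (n ∸ 1)
  diagonal-sizes = begin
    map (classSize colour) (diagonals n)
      ≡⟨ List.map-cong (λ d → sum-remQuot n n (λ z → ⟦ diagonal z ≟ d ⟧)) (diagonals n) ⟩
    map (diagonalSize n) (diagonals n)
      ≡⟨ List.map-++ (diagonalSize n) (applyUpTo +_ n) _ ⟩
    map (diagonalSize n) (applyUpTo +_ n) ++ map (diagonalSize n) (applyUpTo -[1+_] (n ∸ 1))
      ≡⟨ cong₂ _++_ (sizes +_ n (diagonalSize-pos n))
           (sizes -[1+_] (n ∸ 1) λ t → trans (diagonalSize-neg n t) (sym (ℕ.∸-+-assoc n 1 t))) ⟩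
    applyDownFrom suc n ++ applyDownFrom suc (n ∸ 1) ∎
    where
    open ≡-Reasoning
    sizes : ∀ (f : ℕ → ℤ) k → (∀ t → diagonalSize n (f t) ≡ k ∸ t) →
      map (diagonalSize n) (applyUpTo f k) ≡ applyDownFrom suc k
    sizes f k size = trans (List.map-applyUpTo f (diagonalSize n) k)
      (trans (trans (sym (List.map-upTo _ k)) (trans (List.map-cong size _) (List.map-upTo _ k))) (applyUpTo-∸ k))

  colour≡y-x : ∀ i → colour i ≡ proj₂ (position {n} i) - proj₁ (position {n} i)
  colour≡y-x i = sym (ℤ.[1+m]⊖[1+n]≡m⊖n (toℕ (proj₂ (remQuot {n} n i))) (toℕ (proj₁ (remQuot {n} n i))))

  attacks⇒colour : ∀ i j → Attacks (position {n} i) (position {n} j) → colour i ≡ colour j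
  attacks⇒colour i j a =
    trans (colour≡y-x i) (trans (attacks⇒y-x (position {n} i) (position {n} j) a) (sym (colour≡y-x j)))

  colour⇒attacks : ∀ i j → colour i ≡ colour j → Attacks (position {n} i) (position {n} j)
  colour⇒attacks i j e =
    y-x⇒attacks (position {n} i) (position {n} j) (trans (sym (colour≡y-x i)) (trans e (colour≡y-x j)))

  placement≐rainbow : ∀ q → Placement q n ≐ Rainbow colour [] q
  placement≐rainbow q =
    (λ { (s , na) → s , (λ i j i∈ j∈ i≢j → na i j i∈ j∈ i≢j ∘ colour⇒attacks i j) , λ _ _ () })
    , λ { (s , r , _) → s , λ i j i∈ j∈ i≢j → r i j i∈ j∈ i≢j ∘ attacks⇒colour i j }

  -- The identity includes `n = 0`, where the board and both lists are empty. The polynomial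
  -- argument relies on this, since its recurrence in `n` starts at 0.
  u≡esym : ∀ q → u q n ≡ esym q (applyDownFrom suc n ++ applyDownFrom suc (n ∸ 1))
  u≡esym q = begin
    u q n
      ≡⟨ cong length (List.filter-≐ (placement? q n) (rainbow? colour [] q) (placement≐rainbow q) (subsets (n ℕ.* n))) ⟩
    #rainbow colour [] q
      ≡⟨ #rainbow≡esym colour (diagonals-unique n)
           (λ i → ∈-diagonals n _ _ (Fin.toℕ<n (proj₁ (remQuot {n} n i))) (Fin.toℕ<n (proj₂ (remQuot {n} n i)))) [] q ⟩
    esym q (map (weight colour []) (diagonals n))
      ≡⟨ cong (esym q) diagonal-sizes ⟩
    esym q (applyDownFrom suc n ++ applyDownFrom suc (n ∸ 1)) ∎
    where open ≡-Reasoning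

-- Stirling numbers

esym-∷ : ∀ q a as → + esym (suc q) (a ∷ as) ≡ + esym (suc q) as + + a * + esym q as
esym-∷ q a as = trans (ℤ.pos-+ (esym (suc q) as) (a ℕ.* esym q as))
  (cong (_+_ (+ esym (suc q) as)) (ℤ.pos-* a (esym q as)))

-- The generating polynomials `∏ (1 + a t)` of two lists multiply under concatenation; this compares
-- the coefficients of the `q`-th power of `t`.
esym-++ : ∀ q as bs →
  + esym q (as ++ bs) ≡ ∑[ k ≤ q ] (+ esym (toℕ k) as * + esym (q ∸ toℕ k) bs)
esym-++ q [] bs = sym (trans
  (cong₂ _+_ (ℤ.*-identityˡ (+ esym q bs)) (ℤ-Sum.sum-replicate-zero q))
  (ℤ.+-identityʳ (+ esym q bs)))
esym-++ zero (a ∷ as) bs = refl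
esym-++ (suc q) (a ∷ as) bs = begin
  + esym (suc q) (a ∷ as ++ bs)
    ≡⟨ esym-∷ q a (as ++ bs) ⟩
  + esym (suc q) (as ++ bs) + + a * + esym q (as ++ bs)
    ≡⟨ cong₂ (λ x y → x + + a * y) (esym-++ (suc q) as bs) (esym-++ q as bs) ⟩
  -- A sum up to `suc q` unfolds to its term at 0 and a shifted sum. The term `e₀` is common to `as`
  -- and `a ∷ as`, so only the shifted sums have to be combined.
  e₀ + ∑[ k ≤ q ] (f k) + + a * ∑[ k ≤ q ] (g k)
    ≡⟨ cong (_+_ (e₀ + ∑[ k ≤ q ] (f k))) (ℤ-Sum.*-distribˡ-sum (+ a) g) ⟩
  e₀ + ∑[ k ≤ q ] (f k) + ∑[ k ≤ q ] (+ a * g k)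
    ≡⟨ ℤ.+-assoc e₀ _ _ ⟩
  e₀ + (∑[ k ≤ q ] (f k) + ∑[ k ≤ q ] (+ a * g k))
    ≡⟨ cong (_+_ e₀) (ℤ-Sum.∑-distrib-+ f (λ k → + a * g k)) ⟨
  e₀ + ∑[ k ≤ q ] (f k + + a * g k)
    ≡⟨ cong (_+_ e₀) (ℤ-Sum.sum-cong-≗ {suc q} λ k → trans
         (factor (+ esym (suc (toℕ k)) as) (+ a) (+ esym (toℕ k) as) (+ esym (q ∸ toℕ k) bs))
         (cong (_* + esym (q ∸ toℕ k) bs) (sym (esym-∷ (toℕ k) a as)))) ⟩
  e₀ + ∑[ k ≤ q ] (+ esym (suc (toℕ k)) (a ∷ as) * + esym (q ∸ toℕ k) bs) ∎
  where
  open ≡-Reasoning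
  e₀ = 1ℤ * + esym (suc q) bs
  f g : Fin (suc q) → ℤ
  f k = + esym (suc (toℕ k)) as * + esym (q ∸ toℕ k) bs
  g k = + esym (toℕ k) as * + esym (q ∸ toℕ k) bs
  factor : ∀ x a y z → x * z + a * (y * z) ≡ (x + a * y) * z
  factor = ℤ-Solver.solve-∀

stirling₁-> : ∀ a j → stirling₁ a (suc (a ℕ.+ j)) ≡ 0ℤ
stirling₁-> zero    j = refl
stirling₁-> (suc a) j rewrite stirling₁-> a j | sym (ℕ.+-suc a j) | stirling₁-> a (suc j) | ℤ.*-zeroʳ (+ a) = refl

stirling₁-diag : ∀ a → stirling₁ a a ≡ 1ℤ
stirling₁-diag zero    = refl
stirling₁-diag (suc a) = begin
  stirling₁ a a - + a * stirling₁ a (suc a)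
    ≡⟨ cong₂ (λ x y → x - + a * y) (stirling₁-diag a)
         (trans (cong (stirling₁ a ∘ suc) (sym (ℕ.+-identityʳ a))) (stirling₁-> a 0)) ⟩
  1ℤ - + a * 0ℤ
    ≡⟨ cong (λ x → 1ℤ - x) (ℤ.*-zeroʳ (+ a)) ⟩
  1ℤ ∎
  where open ≡-Reasoning

-- Extension by 0 makes the recurrence uniform over all integers `b`: at `b = 0` the term with index
-- -1 vanishes, and below that every term does.
s-rec : ∀ a b → s (suc a) b ≡ s a (ℤ.pred b) - + a * s a b
s-rec a (+ zero)  = sym (ℤ.+-identityˡ _)
s-rec a (+ suc b) = refl
s-rec a -[1+ b ]  rewrite ℤ.*-zeroʳ (+ a) = refl

-- These are Vieta's formulas for `x (x − 1) ⋯ (x − n)`, whose nonzero roots are `1, …, n`. The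
-- integer index `suc n ⊖ k` lets `k` exceed the degree, where both sides are 0.
s≡esym : ∀ n k → s (suc n) (suc n ⊖ k) ≡ -1ℤ ^ k * + esym k (applyDownFrom suc n)
s≡esym n zero = stirling₁-diag (suc n)
s≡esym zero (suc zero) = refl
s≡esym zero (suc (suc k)) = sym (ℤ.*-zeroʳ (-1ℤ ^ suc (suc k)))
s≡esym (suc n) (suc k) = begin
  s (suc (suc n)) (suc (suc n) ⊖ suc k)
    ≡⟨ cong (s (suc (suc n))) (ℤ.[1+m]⊖[1+n]≡m⊖n (suc n) k) ⟩
  s (suc (suc n)) (suc n ⊖ k)
    ≡⟨ s-rec (suc n) (suc n ⊖ k) ⟩
  s (suc n) (ℤ.pred (suc n ⊖ k)) - + suc n * s (suc n) (suc n ⊖ k)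
    ≡⟨ cong (λ b → s (suc n) b - + suc n * s (suc n) (suc n ⊖ k)) (ℤ.distribʳ-⊖-+-neg 0 (suc n) k) ⟩
  s (suc n) (suc n ⊖ suc k) - + suc n * s (suc n) (suc n ⊖ k)
    ≡⟨ cong₂ (λ x y → x - + suc n * y) (s≡esym n (suc k)) (s≡esym n k) ⟩
  -1ℤ * -1ℤ ^ k * + esym (suc k) as - + suc n * (-1ℤ ^ k * + esym k as)
    ≡⟨ factor (-1ℤ ^ k) (+ esym (suc k) as) (+ suc n) (+ esym k as) ⟩
  -1ℤ * -1ℤ ^ k * (+ esym (suc k) as + + suc n * + esym k as)
    ≡⟨ cong (-1ℤ ^ suc k *_) (esym-∷ k (suc n) as) ⟨
  -1ℤ ^ suc k * + esym (suc k) (suc n ∷ as) ∎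
  where
  open ≡-Reasoning
  as = applyDownFrom suc n
  factor : ∀ p x a y → -1ℤ * p * x - a * (p * y) ≡ -1ℤ * p * (x + a * y)
  factor = ℤ-Solver.solve-∀

-1^n*-1^n≡1 : ∀ n → -1ℤ ^ n * -1ℤ ^ n ≡ 1ℤ
-1^n*-1^n≡1 zero    = refl
-1^n*-1^n≡1 (suc n) = trans (square (-1ℤ ^ n)) (-1^n*-1^n≡1 n)
  where
  square : ∀ p → -1ℤ * p * (-1ℤ * p) ≡ p * p
  square = ℤ-Solver.solve-∀

-- Here `suc m` is the side of the board. A square of `-1ℤ ^ q` is inserted; one copy stays in
-- front, and the other splits inside each term into the signs for `k` and `q ∸ k`, which turn the
-- two symmetric polynomials into Stirling numbers.
stirling-sum : ∀ m q → + esym q (applyDownFrom suc (suc m) ++ applyDownFrom suc m) ≡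
  -1ℤ ^ q * ∑[ k ≤ q ] (s (suc (suc m)) (+ suc (suc m) - + toℕ k) * s (suc m) (+ suc m - (+ q - + toℕ k)))
stirling-sum m q = begin
  + esym q (as ++ bs)
    ≡⟨ esym-++ q as bs ⟩
  ∑[ k ≤ q ] (e k)
    ≡⟨ ℤ.*-identityˡ _ ⟨
  1ℤ * ∑[ k ≤ q ] (e k)
    ≡⟨ cong (_* ∑[ k ≤ q ] (e k)) (-1^n*-1^n≡1 q) ⟨
  -1ℤ ^ q * -1ℤ ^ q * ∑[ k ≤ q ] (e k)
    ≡⟨ ℤ.*-assoc (-1ℤ ^ q) (-1ℤ ^ q) _ ⟩
  -1ℤ ^ q * (-1ℤ ^ q * ∑[ k ≤ q ] (e k))
    ≡⟨ cong (-1ℤ ^ q *_) (ℤ-Sum.*-distribˡ-sum (-1ℤ ^ q) e) ⟩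
  -1ℤ ^ q * ∑[ k ≤ q ] (-1ℤ ^ q * e k)
    ≡⟨ cong (-1ℤ ^ q *_) (ℤ-Sum.sum-cong-≗ {suc q} term) ⟩
  -1ℤ ^ q * ∑[ k ≤ q ] (s (suc (suc m)) (+ suc (suc m) - + toℕ k) * s (suc m) (+ suc m - (+ q - + toℕ k))) ∎
  where
  open ≡-Reasoning
  as = applyDownFrom suc (suc m)
  bs = applyDownFrom suc m
  e : Fin (suc q) → ℤ
  e k = + esym (toℕ k) as * + esym (q ∸ toℕ k) bs
  regroup : ∀ x y a b → x * y * (a * b) ≡ x * a * (y * b)
  regroup = ℤ-Solver.solve-∀
  term : ∀ k → -1ℤ ^ q * e k ≡ s (suc (suc m)) (+ suc (suc m) - + toℕ k) * s (suc m) (+ suc m - (+ q - + toℕ k))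
  term k = begin
    -1ℤ ^ q * e k
      ≡⟨ cong (λ r → -1ℤ ^ r * e k) (ℕ.m+[n∸m]≡n k≤q) ⟨
    -1ℤ ^ (toℕ k ℕ.+ (q ∸ toℕ k)) * e k
      ≡⟨ cong (_* e k) (ℤ.^-distribˡ-+-* -1ℤ (toℕ k) (q ∸ toℕ k)) ⟩
    -1ℤ ^ toℕ k * -1ℤ ^ (q ∸ toℕ k) * e k
      ≡⟨ regroup (-1ℤ ^ toℕ k) (-1ℤ ^ (q ∸ toℕ k)) (+ esym (toℕ k) as) (+ esym (q ∸ toℕ k) bs) ⟩
    -1ℤ ^ toℕ k * + esym (toℕ k) as * (-1ℤ ^ (q ∸ toℕ k) * + esym (q ∸ toℕ k) bs)
      ≡⟨ cong₂ _*_ (s≡esym (suc m) (toℕ k)) (s≡esym m (q ∸ toℕ k)) ⟨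
    s (suc (suc m)) (suc (suc m) ⊖ toℕ k) * s (suc m) (suc m ⊖ (q ∸ toℕ k))
      ≡⟨ cong₂ (λ x y → s (suc (suc m)) x * s (suc m) y)
           (ℤ.[+m]-[+n]≡m⊖n (suc (suc m)) (toℕ k))
           (trans (cong (_-_ (+ suc m)) (trans (ℤ.[+m]-[+n]≡m⊖n q (toℕ k)) (ℤ.⊖-≥ k≤q)))
                  (ℤ.[+m]-[+n]≡m⊖n (suc m) (q ∸ toℕ k))) ⟨
    s (suc (suc m)) (+ suc (suc m) - + toℕ k) * s (suc m) (+ suc m - (+ q - + toℕ k)) ∎
    where k≤q = Fin.toℕ≤pred[n] k

-- Polynomial functions

-- Opaque, because unification would otherwise normalise fractions.
opaque
  ι : ℕ → ℚ
  ι n = + n ℚ./ 1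

  ι-+ : ∀ m n → ι (m ℕ.+ n) ≡ ι m ℚ.+ ι n
  ι-+ m n = ℚ.toℚᵘ-injective (begin
    ℚ.toℚᵘ (ι (m ℕ.+ n))              ≈⟨ ℚ.toℚᵘ-fromℚᵘ (ℚᵘ.mkℚᵘ (+ (m ℕ.+ n)) 0) ⟩
    ℚᵘ.mkℚᵘ (+ (m ℕ.+ n)) 0           ≈⟨ ℚᵘ.*≡* (lemma (+ m) (+ n)) ⟩
    ℚᵘ.mkℚᵘ (+ m) 0 ℚᵘ.+ ℚᵘ.mkℚᵘ (+ n) 0
      ≈⟨ ℚᵘ.+-cong (ℚ.toℚᵘ-fromℚᵘ (ℚᵘ.mkℚᵘ (+ m) 0)) (ℚ.toℚᵘ-fromℚᵘ (ℚᵘ.mkℚᵘ (+ n) 0)) ⟨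
    ℚ.toℚᵘ (ι m) ℚᵘ.+ ℚ.toℚᵘ (ι n)    ≈⟨ ℚ.toℚᵘ-homo-+ (ι m) (ι n) ⟨
    ℚ.toℚᵘ (ι m ℚ.+ ι n) ∎)
    where
    open ℚᵘ.≃-Reasoning
    lemma : ∀ i j → (i ℤ.+ j) ℤ.* + 1 ≡ (i ℤ.* + 1 ℤ.+ j ℤ.* + 1) ℤ.* + 1
    lemma = ℤ-Solver.solve-∀

  ι-* : ∀ m n → ι (m ℕ.* n) ≡ ι m ℚ.* ι n
  ι-* m n = ℚ.toℚᵘ-injective (begin
    ℚ.toℚᵘ (ι (m ℕ.* n))              ≈⟨ ℚ.toℚᵘ-fromℚᵘ (ℚᵘ.mkℚᵘ (+ (m ℕ.* n)) 0) ⟩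
    ℚᵘ.mkℚᵘ (+ (m ℕ.* n)) 0           ≈⟨ ℚᵘ.*≡* (cong (ℤ._* + 1) (ℤ.pos-* m n)) ⟩
    ℚᵘ.mkℚᵘ (+ m) 0 ℚᵘ.* ℚᵘ.mkℚᵘ (+ n) 0
      ≈⟨ ℚᵘ.*-cong (ℚ.toℚᵘ-fromℚᵘ (ℚᵘ.mkℚᵘ (+ m) 0)) (ℚ.toℚᵘ-fromℚᵘ (ℚᵘ.mkℚᵘ (+ n) 0)) ⟨
    ℚ.toℚᵘ (ι m) ℚᵘ.* ℚ.toℚᵘ (ι n)    ≈⟨ ℚ.toℚᵘ-homo-* (ι m) (ι n) ⟨
    ℚ.toℚᵘ (ι m ℚ.* ι n) ∎)
    where open ℚᵘ.≃-Reasoning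

  ι-1 : ι 1 ≡ 1ℚ
  ι-1 = refl

  ι-def : ∀ n → ι n ≡ + n ℚ./ 1
  ι-def n = refl

  ι-positive : ∀ d → ℚ.Positive (ι (suc d))
  ι-positive d = ℚ.normalize-pos (suc d) 1

instance
  ι-nonZero : ∀ {d} → ℚ.NonZero (ι (suc d))
  ι-nonZero {d} = ℚ.pos⇒nonZero (ι (suc d)) {{ι-positive d}}

ι-suc : ∀ n → ι (suc n) ≡ 1ℚ ℚ.+ ι n
ι-suc n = trans (ι-+ 1 n) (cong (ℚ._+ ι n) ι-1)

2ℚ : ℚ
2ℚ = 1ℚ ℚ.+ 1ℚ

-- Polynomials of degree less than `d`, given by stripping off top terms: `a` is the coefficient of
-- the `d`-th power in the successor case. Being a property of functions, it reduces closure under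
-- arithmetic to pointwise ring identities.
PolyBelow : ℕ → (ℕ → ℚ) → Set
PolyBelow zero    f = ∀ n → f n ≡ 0ℚ
PolyBelow (suc d) f = Σ[ a ∈ ℚ ] PolyBelow d (λ n → f n ℚ.- a ℚ.* ι (n ℕ.^ d))

-- The coefficient `a` may be 0 here; that it is nonzero is tracked separately, through positivity.
Leading : ℕ → ℚ → (ℕ → ℚ) → Set
Leading d a f = PolyBelow d (λ n → f n ℚ.- a ℚ.* ι (n ℕ.^ d))

below-cong : ∀ d {f g} → (∀ n → f n ≡ g n) → PolyBelow d f → PolyBelow d g
below-cong zero    f≡g p       n = trans (sym (f≡g n)) (p n)
below-cong (suc d) f≡g (a , p) = a , below-cong d (λ n → cong (ℚ._- a ℚ.* ι (n ℕ.^ d)) (f≡g n)) p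

below-0 : ∀ d → PolyBelow d (λ _ → 0ℚ)
below-0 zero    n = refl
below-0 (suc d) = 0ℚ , below-cong d (λ n → solve 1 (λ x → con 0ℚ := con 0ℚ :- con 0ℚ :* x) refl (ι (n ℕ.^ d))) (below-0 d)

below-+ : ∀ d {f g} → PolyBelow d f → PolyBelow d g → PolyBelow d (λ n → f n ℚ.+ g n)
below-+ zero    p q n = cong₂ ℚ._+_ (p n) (q n)
below-+ (suc d) {f} {g} (a , p) (b , q) = a ℚ.+ b , below-cong d
  (λ n → solve 5 (λ f g a b x → f :- a :* x :+ (g :- b :* x) := f :+ g :- (a :+ b) :* x) refl
    (f n) (g n) a b (ι (n ℕ.^ d)))
  (below-+ d p q)

below-* : ∀ d c {f} → PolyBelow d f → PolyBelow d (λ n → c ℚ.* f n)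
below-* zero    c p n = trans (cong (c ℚ.*_) (p n)) (ℚ.*-zeroʳ c)
below-* (suc d) c {f} (a , p) = c ℚ.* a , below-cong d
  (λ n → solve 4 (λ c f a x → c :* (f :- a :* x) := c :* f :- (c :* a) :* x) refl c (f n) a (ι (n ℕ.^ d)))
  (below-* d c p)

below-suc : ∀ d {f} → PolyBelow d f → PolyBelow (suc d) f
below-suc d {f} p = 0ℚ , below-cong d
  (λ n → solve 2 (λ f x → f := f :- con 0ℚ :* x) refl (f n) (ι (n ℕ.^ d))) p

below-monomial : ∀ d a → PolyBelow (suc d) (λ n → a ℚ.* ι (n ℕ.^ d))
below-monomial d a = a , below-cong d (λ n → sym (ℚ.+-inverseʳ (a ℚ.* ι (n ℕ.^ d)))) (below-0 d)

-- The two lemmas are mutually recursive: multiplication by `n` turns the top term into a monomial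
-- of the next degree, and the remainder satisfies a smaller bound.
below-shift : ∀ d {f} → PolyBelow d f → PolyBelow (suc d) (λ n → ι n ℚ.* f n)
leading-shift : ∀ d a {f} → Leading d a f → Leading (suc d) a (λ n → ι n ℚ.* f n)

below-shift zero    p       = below-suc 0 λ n → trans (cong (ι n ℚ.*_) (p n)) (ℚ.*-zeroʳ (ι n))
below-shift (suc d) (a , p) = a , leading-shift d a p

leading-shift d a {f} p = below-cong (suc d)
  (λ n → trans (solve 4 (λ n f a x → n :* (f :- a :* x) := n :* f :- a :* (n :* x)) refl (ι n) (f n) a (ι (n ℕ.^ d)))
               (cong (λ x → ι n ℚ.* f n ℚ.- a ℚ.* x) (sym (ι-* n (n ℕ.^ d)))))
  (below-shift d p)

leading-+-below : ∀ d a {f g} → Leading d a f → PolyBelow d g → Leading d a (λ n → f n ℚ.+ g n)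
leading-+-below d a {f} {g} p q = below-cong d
  (λ n → solve 4 (λ f g a x → f :- a :* x :+ g := f :+ g :- a :* x) refl (f n) (g n) a (ι (n ℕ.^ d)))
  (below-+ d p q)

leading-* : ∀ d c a {f} → Leading d a f → Leading d (c ℚ.* a) (λ n → c ℚ.* f n)
leading-* d c a {f} p = below-cong d
  (λ n → solve 4 (λ c f a x → c :* (f :- a :* x) := c :* f :- (c :* a) :* x) refl c (f n) a (ι (n ℕ.^ d)))
  (below-* d c p)

leading-cong : ∀ d a {f g} → (∀ n → f n ≡ g n) → Leading d a f → Leading d a g
leading-cong d a f≡g = below-cong d λ n → cong (ℚ._- a ℚ.* ι (n ℕ.^ d)) (f≡g n)

Δ : (ℕ → ℚ) → ℕ → ℚ
Δ f n = f (suc n) ℚ.- f n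

-- If `δ` is the remainder of the difference of the power `suc k`, then the remainder for
-- `suc (suc k)` is `n δ + δ + (k + 1) n^k`. This induction takes the place of the binomial
-- expansion.
leading-Δ-power : ∀ k → Leading k (ι (suc k)) (Δ (λ n → ι (n ℕ.^ suc k)))
leading-Δ-power zero n
  rewrite ι-* (suc n) 1 | ι-* n 1 | ι-suc n | ι-1 =
  solve 1 (λ x → (con 1ℚ :+ x) :* con 1ℚ :- x :* con 1ℚ :- con 1ℚ :* con 1ℚ := con 0ℚ) refl (ι n)
leading-Δ-power (suc k) = below-cong (suc k) step
  (below-+ (suc k) {λ n → ι n ℚ.* δ n ℚ.+ δ n} {λ n → ι (suc k) ℚ.* ι (n ℕ.^ k)}
    (below-+ (suc k) {λ n → ι n ℚ.* δ n} {δ} (below-shift k {δ} D) (below-suc k {δ} D))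
    (below-monomial k (ι (suc k))))
  where
  δ : ℕ → ℚ
  δ n = Δ (λ n → ι (n ℕ.^ suc k)) n ℚ.- ι (suc k) ℚ.* ι (n ℕ.^ k)
  D : PolyBelow k δ
  D = leading-Δ-power k
  step : ∀ n →
    ι n ℚ.* δ n ℚ.+ δ n ℚ.+ ι (suc k) ℚ.* ι (n ℕ.^ k) ≡
    Δ (λ n → ι (n ℕ.^ suc (suc k))) n ℚ.- ι (suc (suc k)) ℚ.* ι (n ℕ.^ suc k)
  step n
    rewrite ι-* (suc n) (suc n ℕ.^ suc k) | ι-* n (n ℕ.^ suc k) | ι-* n (n ℕ.^ k) | ι-suc n | ι-suc (suc k) =
    solve 4 (λ n y x c →
        n :* (y :- n :* x :- c :* x) :+ (y :- n :* x :- c :* x) :+ c :* x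
        := (con 1ℚ :+ n) :* y :- n :* (n :* x) :- (con 1ℚ :+ c) :* (n :* x))
      refl (ι n) (ι (suc n ℕ.^ suc k)) (ι (n ℕ.^ k)) (ι (suc k))

-- Discrete integration, by recursion on the degree of the difference: the top term is integrated
-- first and the remainder recursively. At the bottom a function with zero difference is the
-- constant `f 0`.
antidifference : ∀ d {f} → PolyBelow d (Δ f) → PolyBelow (suc d) f
leading-antidifference : ∀ d a {f} → Leading d a (Δ f) → Leading (suc d) (a ℚ.* ℚ.1/ ι (suc d)) f

antidifference zero {f} p = f 0 , λ n → trans (cong₂ (λ x y → x ℚ.- f 0 ℚ.* y) (constant n) ι-1)
  (solve 1 (λ x → x :- x :* con 1ℚ := con 0ℚ) refl (f 0))
  where
  constant : ∀ n → f n ≡ f 0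
  constant zero    = refl
  constant (suc n) = trans
    (solve 2 (λ x y → x := x :- y :+ y) refl (f (suc n)) (f n))
    (trans (cong (ℚ._+ f n) (p n)) (trans (ℚ.+-identityˡ (f n)) (constant n)))
antidifference (suc d) {f} (a , p) = a ℚ.* ℚ.1/ ι (suc d) , leading-antidifference d a {f} p

-- By `leading-Δ-power`, the difference of `b n^(d+1)` has leading coefficient `b (d + 1)`; the
-- choice of `b` makes this `a`, so subtracting that monomial lowers the degree of the difference.
leading-antidifference d a {f} p = antidifference d {λ n → f n ℚ.- b ℚ.* ι (n ℕ.^ suc d)} (below-cong d step
  (below-+ d p (below-* d (ℚ.- b) (leading-Δ-power d))))
  where
  b = a ℚ.* ℚ.1/ ι (suc d)
  b*[1+d]≡a : b ℚ.* ι (suc d) ≡ a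
  b*[1+d]≡a = trans (ℚ.*-assoc a _ _) (trans (cong (a ℚ.*_) (ℚ.*-inverseˡ (ι (suc d)))) (ℚ.*-identityʳ a))
  step : ∀ n →
    Δ f n ℚ.- a ℚ.* ι (n ℕ.^ d) ℚ.+ (ℚ.- b) ℚ.* (Δ (λ n → ι (n ℕ.^ suc d)) n ℚ.- ι (suc d) ℚ.* ι (n ℕ.^ d)) ≡
    Δ (λ n → f n ℚ.- b ℚ.* ι (n ℕ.^ suc d)) n
  step n = trans
    (cong (λ a → Δ f n ℚ.- a ℚ.* ι (n ℕ.^ d) ℚ.+
                 (ℚ.- b) ℚ.* (Δ (λ n → ι (n ℕ.^ suc d)) n ℚ.- ι (suc d) ℚ.* ι (n ℕ.^ d)))
          (sym b*[1+d]≡a))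
    (solve 7 (λ f′ f b c x y′ y →
        f′ :- f :- (b :* c) :* x :+ (:- b) :* (y′ :- y :- c :* x) := f′ :- b :* y′ :- (f :- b :* y))
      refl (f (suc n)) (f n) b (ι (suc d)) (ι (n ℕ.^ d)) (ι (suc n ℕ.^ suc d)) (ι (n ℕ.^ suc d)))

-- `PolyBelow` yields the top coefficient first, while coefficient vectors are indexed by ascending
-- exponent, so each new coefficient goes to the end.
snoc : ∀ {d} → Vector ℚ d → ℚ → Vector ℚ (suc d)
snoc {zero}  c a _       = a
snoc {suc d} c a zero    = c zero
snoc {suc d} c a (suc i) = snoc (tail c) a i

snoc-last : ∀ {d} (c : Vector ℚ d) a → snoc c a (fromℕ d) ≡ a
snoc-last {zero}  c a = refl
snoc-last {suc d} c a = snoc-last (tail c) a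

sum-snoc : ∀ {d} (c : Vector ℚ d) a (w : ℕ → ℚ) →
  ℚ-Sum.sum (λ i → snoc c a i ℚ.* w (toℕ i)) ≡ ℚ-Sum.sum (λ i → c i ℚ.* w (toℕ i)) ℚ.+ a ℚ.* w d
sum-snoc {zero}  c a w = ℚ.+-comm (a ℚ.* w 0) 0ℚ
sum-snoc {suc d} c a w = trans
  (cong (c zero ℚ.* w 0 ℚ.+_) (sum-snoc (tail c) a (λ i → w (suc i))))
  (sym (ℚ.+-assoc (c zero ℚ.* w 0) _ _))

coefficients : ∀ d {f} → PolyBelow d f → Vector ℚ d
coefficients zero    _       ()
coefficients (suc d) (a , p) = snoc (coefficients d p) a

below-eval : ∀ d {f} (p : PolyBelow d f) n →
  f n ≡ ℚ-Sum.sum (λ i → coefficients d p i ℚ.* ι (n ℕ.^ toℕ i))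
below-eval zero        p       n = p n
below-eval (suc d) {f} (a , p) n = begin
  f n
    ≡⟨ solve 2 (λ f x → f := f :- x :+ x) refl (f n) (a ℚ.* ι (n ℕ.^ d)) ⟩
  f n ℚ.- a ℚ.* ι (n ℕ.^ d) ℚ.+ a ℚ.* ι (n ℕ.^ d)
    ≡⟨ cong (ℚ._+ a ℚ.* ι (n ℕ.^ d)) (below-eval d p n) ⟩
  ℚ-Sum.sum (λ i → coefficients d p i ℚ.* ι (n ℕ.^ toℕ i)) ℚ.+ a ℚ.* ι (n ℕ.^ d)
    ≡⟨ sum-snoc (coefficients d p) a (λ i → ι (n ℕ.^ i)) ⟨
  ℚ-Sum.sum (λ i → snoc (coefficients d p) a i ℚ.* ι (n ℕ.^ toℕ i)) ∎
  where open ≡-Reasoning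

-- The recurrence in the board size, degree and leading coefficient

-- A case of the symmetry of `esym`: expanding in `a` and `b` gives `x + (a + b) y + a b z` for
-- either order. Size 1 is separate because the product term is then absent.
esym-middle : ∀ q as b bs → esym q (as ++ b ∷ bs) ≡ esym q (b ∷ as ++ bs)
esym-middle zero    as       b bs = refl
esym-middle (suc q) []       b bs = refl
esym-middle (suc zero) (a ∷ as) b bs rewrite esym-middle 1 as b bs = lemma (esym 1 (as ++ bs)) a b
  where
  lemma : ∀ x a b → x ℕ.+ b ℕ.* 1 ℕ.+ a ℕ.* 1 ≡ x ℕ.+ a ℕ.* 1 ℕ.+ b ℕ.* 1
  lemma = solve-∀
esym-middle (suc (suc q)) (a ∷ as) b bs
  rewrite esym-middle (suc (suc q)) as b bs | esym-middle (suc q) as b bs =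
  lemma (esym (suc (suc q)) (as ++ bs)) (esym (suc q) (as ++ bs)) (esym q (as ++ bs)) a b
  where
  lemma : ∀ x y z a b → x ℕ.+ b ℕ.* y ℕ.+ a ℕ.* (y ℕ.+ b ℕ.* z) ≡ x ℕ.+ a ℕ.* y ℕ.+ b ℕ.* (y ℕ.+ a ℕ.* z)
  lemma = solve-∀

sizes : ℕ → List ℕ
sizes n = applyDownFrom suc n ++ applyDownFrom suc (n ∸ 1)

-- The first half gains the head `suc n`; the second half gains `n`, which is moved to the front.
-- For `n = 0` the second half gains nothing, and the entry 0 on the right does not contribute.
esym-sizes-suc : ∀ q n → esym q (sizes (suc n)) ≡ esym q (suc n ∷ n ∷ sizes n)
esym-sizes-suc zero    n = refl
esym-sizes-suc (suc q) n = cong₂ (λ x y → x ℕ.+ suc n ℕ.* y) (double (suc q) n) (double q n)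
  where
  double : ∀ q n → esym q (applyDownFrom suc n ++ applyDownFrom suc n) ≡ esym q (n ∷ sizes n)
  double q zero    = sym (esym-0∷ q [])
  double q (suc n) = esym-middle q (applyDownFrom suc (suc n)) (suc n) (applyDownFrom suc n)

E : ℕ → ℕ → ℚ
E q n = ι (esym q (sizes n))

-- The index is lowered by one, with value 0 below index 0, so that one recurrence covers `q = 0`
-- too.
E₋₁ : ℕ → ℕ → ℚ
E₋₁ zero    n = 0ℚ
E₋₁ (suc q) n = E q n

-- The new entries `n + 1` and `n` have sum `2n + 1` and product `n (n + 1)`. The right side is
-- grouped by degree: the first summand has degree `2q + 1`, and all the others have degree at most
-- `2q`.
Δ-E : ∀ q n → Δ (E (suc q)) n ≡
  ι n ℚ.* (2ℚ ℚ.* E q n) ℚ.+ (E q n ℚ.+ (ι n ℚ.* (ι n ℚ.* E₋₁ q n) ℚ.+ ι n ℚ.* E₋₁ q n))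
Δ-E zero n
  rewrite esym-sizes-suc 1 n
        | ι-+ (esym 1 (sizes n) ℕ.+ n ℕ.* 1) (suc n ℕ.* 1) | ι-+ (esym 1 (sizes n)) (n ℕ.* 1)
        | ι-* n 1 | ι-* (suc n) 1 | ι-suc n | ι-1 =
  solve 2 (λ x n → x :+ n :* con 1ℚ :+ (con 1ℚ :+ n) :* con 1ℚ :- x :=
      n :* (con (2ℚ) :* con 1ℚ) :+ (con 1ℚ :+ (n :* (n :* con 0ℚ) :+ n :* con 0ℚ)))
    refl (E 1 n) (ι n)
Δ-E (suc q) n
  rewrite esym-sizes-suc (suc (suc q)) n
        | ι-+ (esym (suc (suc q)) (n ∷ sizes n)) (suc n ℕ.* esym (suc q) (n ∷ sizes n))
        | ι-* (suc n) (esym (suc q) (n ∷ sizes n))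
        | ι-+ (esym (suc (suc q)) (sizes n)) (n ℕ.* esym (suc q) (sizes n))
        | ι-+ (esym (suc q) (sizes n)) (n ℕ.* esym q (sizes n))
        | ι-* n (esym (suc q) (sizes n)) | ι-* n (esym q (sizes n)) | ι-suc n =
  solve 4 (λ x y z n → x :+ n :* y :+ (con 1ℚ :+ n) :* (y :+ n :* z) :- x :=
      n :* (con (2ℚ) :* y) :+ (y :+ (n :* (n :* z) :+ n :* z)))
    refl (E (suc (suc q)) n) (E (suc q) n) (E q n) (ι n)

-- q * 2 rather than 2 * q, since suc q * 2 computes to suc (suc (q * 2)).
leading-E : ∀ q → Σ[ a ∈ ℚ ] (ℚ.Positive a × Leading (q ℕ.* 2) a (E q))
below-E₋₁ : ∀ q → PolyBelow (suc (q ℕ.* 2)) (λ n → ι n ℚ.* (ι n ℚ.* E₋₁ q n) ℚ.+ ι n ℚ.* E₋₁ q n)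

leading-E zero    = 1ℚ , _ , λ n → solve 1 (λ x → x :- con 1ℚ :* x := con 0ℚ) refl (ι 1)
leading-E (suc q) with a , a>0 , p ← leading-E q =
  -- The difference has top term `2 a n^(2q+1)`, and integrating divides by `2q + 2`. The
  -- coefficient thus passes from `a` to `a / (q + 1)`, which gives `1 / q!` in all.
  2ℚ ℚ.* a ℚ.* ℚ.1/ ι (suc d) ,
  ℚ.pos*pos⇒pos (2ℚ ℚ.* a) {{ℚ.pos*pos⇒pos 2ℚ a {{a>0}}}}
    (ℚ.1/ ι (suc d)) {{ℚ.1/pos⇒pos (ι (suc d)) {{ι-positive d}}}} ,
  leading-antidifference d (2ℚ ℚ.* a) {E (suc q)} (leading-cong d (2ℚ ℚ.* a) (λ n → sym (Δ-E q n))
    (leading-+-below d (2ℚ ℚ.* a) {λ n → ι n ℚ.* (2ℚ ℚ.* E q n)}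
      (leading-shift (q ℕ.* 2) (2ℚ ℚ.* a) {λ n → 2ℚ ℚ.* E q n} (leading-* (q ℕ.* 2) 2ℚ a {E q} p))
      (below-+ d {E q} (a , p) (below-E₋₁ q))))
  where
  d = suc (q ℕ.* 2)

below-E₋₁ zero    = below-cong 1
  (λ n → solve 1 (λ n → con 0ℚ := n :* (n :* con 0ℚ) :+ n :* con 0ℚ) refl (ι n)) (below-0 1)
below-E₋₁ (suc q) with a , _ , p ← leading-E q =
  -- Each factor `n` raises the bound by one, from `2q + 1` for `E q` to `2q + 3`, the bound
  -- required at `suc q`.
  below-+ (suc (suc d)) {λ n → ι n ℚ.* (ι n ℚ.* E q n)}
    (below-shift (suc d) {λ n → ι n ℚ.* E q n} nE) (below-suc (suc d) {λ n → ι n ℚ.* E q n} nE)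
  where
  d = suc (q ℕ.* 2)
  nE : PolyBelow (suc d) (λ n → ι n ℚ.* E q n)
  nE = below-shift d {E q} (a , p)

leading⇒polynomial : ∀ d a {f : ℕ → ℕ} → ℚ.Positive a → Leading d a (λ n → ι (f n)) → IsPolynomialOfDegree d f
leading⇒polynomial d a {f} a>0 p = c , c≢0 , λ n _ → begin
  + f n ℚ./ 1
    ≡⟨ ι-def (f n) ⟨
  ι (f n)
    ≡⟨ below-eval (suc d) {λ n → ι (f n)} (a , p) n ⟩
  ℚ-Sum.sum (λ i → c i ℚ.* ι (n ℕ.^ toℕ i))
    ≡⟨ ℚ-Sum.sum-cong-≗ {suc d} (λ i → cong (c i ℚ.*_) (ι-def (n ℕ.^ toℕ i))) ⟩
  ℚ-Sum.sum (λ i → c i ℚ.* (+ (n ℕ.^ toℕ i) ℚ./ 1)) ∎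
  where
  open ≡-Reasoning
  c = coefficients (suc d) {λ n → ι (f n)} (a , p)
  c≢0 : c (fromℕ d) ≢ 0ℚ
  c≢0 c≡0 = ℚ.<⇒≢ (ℚ.positive⁻¹ a {{a>0}}) (trans (sym c≡0) (snoc-last (coefficients d p) a))

u-polynomial : ∀ q → IsPolynomialOfDegree (2 ℕ.* q) (u q)
u-polynomial q =
  let a , a>0 , p = leading-E q in
  subst (λ d → IsPolynomialOfDegree d (u q)) (ℕ.*-comm q 2)
    (leading⇒polynomial (q ℕ.* 2) a a>0
      (leading-cong (q ℕ.* 2) a {E q} (λ n → cong ι (sym (u≡esym n q))) p))

theorem7p2 : ∀ (q : ℕ) → 1 ≤ q →
    (∀ (n : ℕ) → 1 ≤ n →
    + u q n ≡ -1ℤ ^ q * (∑[ k ≤ q ] (s (suc n) (+ suc n - + toℕ k) * s n (+ n - (+ q - + toℕ k)))))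
    × IsPolynomialOfDegree (2 ℕ.* q) (u q)
-- Writing the side as `suc m` makes `n ∸ 1` compute to `m`, the length of the second list.
theorem7p2 q _ = (λ { (suc m) _ → trans (cong +_ (u≡esym (suc m) q)) (stirling-sum m q) }) , u-polynomial q
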